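{- Let $\mathcal{B}$ be a Turing-complete basis of primitive combinators. Then asymptotically every weakly normalising $\mathcal{B}$-combinator is not strongly normalising, i.e. $$\lim_{n\to\infty}\frac{|\{P\in\mathcal{C}_{\mathcal{B}}: |P|=n,\ P \text{ is weakly normalising and not strongly normalising}\}|}{|\{P\in\mathcal{C}_{\mathcal{B}}: |P|=n,\ P \text{ is weakly normalising}\}|}=1 .$$
   Context: Combinators. Let $\mathcal{B}$ be a finite basis of primitive combinators. The set $\mathcal{C}_{\mathcal{B}}$ of $\mathcal{B}$-combinators is the smallest set containing $\mathcal{B}$ and closed under application $(N,M)\mapsto (NM)$; application associates to the left. The size $|P|$ is the number of applications in $P$. Reduction. Each primitive $\mathbf{X}\in\mathcal{B}$ comes with one reduction rule $\mathbf{X}N_1\ldots N_m\to M$ with $m\ge 1$, where $N_1,\ldots,N_m$ are arbitrary combinators and $M$ is a fixed term built from $N_1,\ldots,N_m$ by application. The relation is extended so that $P\to Q$ implies $PR\to QR$ and $RP\to RQ$ for every combinator $R$. $P$ is in normal form if there is no $Q$ with $P\to Q$. $P$ is weakly normalising if there is a finite sequence $P=P_0\to P_1\to\cdots\to P_k$ with $P_k$ in normal form; $P$ is strongly normalising if there is no infinite sequence $P=P_0\to P_1\to\cdots$. Turing-completeness. $\mathcal{B}$ is Turing-complete if there are $\mathcal{B}$-combinators extensionally equivalent to $\mathbf{S}$ and to $\mathbf{K}$, where $\mathbf{S}xyz\to xz(yz)$ and $\mathbf{K}xy\to x$. Here a $\mathcal{B}$-combinator $N$ is extensionally equivalent to $\mathbf{S}$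 (resp. $\mathbf{K}$) if, over terms built from $\mathcal{B}$ and fresh variables $x,y,z$, $Nxyz$ is convertible to $xz(yz)$ (resp. $Nxy$ is convertible to $x$), convertibility being the equivalence relation generated by $\to$. -}

module Defs where

open import Data.Empty using (⊥)
open import Data.Fin.Base using (Fin)
open import Data.Fin.Patterns using (0F; 1F; 2F)
open import Data.Integer.Base using (+_)
open import Data.List.Base using (List; []; _∷_; length; map; _++_; allFin; cartesianProductWith)
open import Data.List.Membership.Propositional using (_∈_)
open import Data.List.Membership.Propositional.Properties
  using (∈-map⁺; ∈-allFin; ∈-++⁺ˡ; ∈-++⁺ʳ; ∈-cartesianProductWith⁺)
open import Data.List.Membership.Propositional.Properties.WithK using (unique∧set⇒bag)
open import Data.List.Relation.Binary.BagAndSetEquality using (∼bag⇒↭)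
open import Data.List.Relation.Binary.Permutation.Propositional.Properties
  using (↭-length)
open import Data.List.Relation.Unary.All as All using ()
open import Data.List.Relation.Unary.AllPairs using ([]; _∷_)
open import Data.List.Relation.Unary.Any using (here; there)
open import Data.List.Relation.Unary.Unique.Propositional using (Unique)
open import Data.Nat.Base as ℕ using (ℕ; zero; suc; NonZero; s≤s)
open import Data.Nat.Properties using (≤-reflexive; ≤-trans; m≤m+n; m≤n+m)
open import Data.Product using (∃; ∃-syntax; Σ-syntax; _×_; _,_; proj₁; proj₂)
open import Data.Rational.Base as ℚ using (ℚ; 0ℚ; _/_; _-_; ∣_∣)
open import Data.Vec.Base using (Vec; []; _∷_; lookup)
open import Function.Bundles using (_⇔_; mk⇔; Equivalence)
open import Function.Construct.Composition using (_⇔-∘_)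
open import Function.Construct.Symmetry using (⇔-sym)
open import Level using (0ℓ)
open import Relation.Binary.Construct.Closure.Equivalence using (EqClosure)
open import Relation.Binary.PropositionalEquality using (_≡_; refl)
open import Relation.Binary.Rewriting using (HasNormalForm)
open import Relation.Nullary using (¬_; Dec; yes; no)
open import Relation.Nullary.Decidable using (¬¬-excluded-middle)
open import Relation.Nullary.Negation using (contradiction)
open import Relation.Unary using (Pred)

infixl 9 _·_

-- The right-hand side M of a rule X N₁ … Nₘ → M: `arg i` stands for Nᵢ.
data Rhs (m : ℕ) : Set where
  arg : Fin m → Rhs m
  _·_ : Rhs m → Rhs m → Rhs m

record Basis : Set where
  field
    #prims        : ℕ
    arity         : Fin #prims → ℕ
    arity-nonZero : ∀ X → NonZero (arity X)
    rhs           : ∀ X → Rhs (arity X)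

  Primitive : Set
  Primitive = Fin #prims

module _ (ℬ : Basis) where
  open Basis ℬ

  infixl 9 _·_

  data Term (V : Set) : Set where
    prim : Primitive → Term V
    var  : V → Term V
    _·_  : Term V → Term V → Term V

  Combinator : Set
  Combinator = Term ⊥

module _ {ℬ : Basis} where
  open Basis ℬ

  size : ∀ {V} → Term ℬ V → ℕ
  size (prim X) = 0
  size (var x)  = 0
  size (P · Q)  = suc (size P ℕ.+ size Q)

  weaken : ∀ {V} → Combinator ℬ → Term ℬ V
  weaken (prim X) = prim X
  weaken (P · Q)  = weaken P · weaken Q

  infixl 9 _·*_

  _·*_ : ∀ {V m} → Term ℬ V → Vec (Term ℬ V) m → Term ℬ V
  P ·* []       = P
  P ·* (N ∷ Ns) = (P · N) ·* Ns

  instantiate : ∀ {V m} → Rhs m → Vec (Term ℬ V) m → Term ℬ V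
  instantiate (arg i) Ns = lookup Ns i
  instantiate (M · N) Ns = instantiate M Ns · instantiate N Ns

  infix 4 _⟶_ _≃_

  data _⟶_ {V : Set} : Term ℬ V → Term ℬ V → Set where
    contract : ∀ X (Ns : Vec (Term ℬ V) (arity X)) →
               prim X ·* Ns ⟶ instantiate (rhs X) Ns
    appˡ     : ∀ {P Q R} → P ⟶ Q → P · R ⟶ Q · R
    appʳ     : ∀ {P Q R} → P ⟶ Q → R · P ⟶ R · Q

  _≃_ : ∀ {V} → Term ℬ V → Term ℬ V → Set
  _≃_ = EqClosure _⟶_

  WeaklyNormalising : Pred (Combinator ℬ) 0ℓ
  WeaklyNormalising = HasNormalForm _⟶_

  StronglyNormalising : Pred (Combinator ℬ) 0ℓ
  StronglyNormalising P =
    ¬ (Σ[ f ∈ (ℕ → Combinator ℬ) ] f 0 ≡ P × (∀ i → f i ⟶ f (suc i)))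

  private
    x y z : Term ℬ (Fin 3)
    x = var 0F
    y = var 1F
    z = var 2F

  ExtensionallyS ExtensionallyK : Pred (Combinator ℬ) 0ℓ
  ExtensionallyS N = weaken N · x · y · z ≃ x · z · (y · z)
  ExtensionallyK N = weaken N · x · y ≃ x

TuringComplete : Pred Basis 0ℓ
TuringComplete ℬ = ∃ (ExtensionallyS {ℬ}) × ∃ (ExtensionallyK {ℬ})

-- Cardinality is a relation rather than a function because the predicates
-- counted below are undecidable. It is single-valued (`cardinality-unique`),
-- and for combinators of a given size it is classically total
-- (`cardinality-exists`).
HasCardinality : {A : Set} → Pred A 0ℓ → ℕ → Set
HasCardinality P k =
  ∃[ xs ] Unique xs × (∀ x → x ∈ xs ⇔ P x) × length xs ≡ k

-- lim |P n| / |Q n| = l. The denominator is required to be eventually nonzero.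
RatioTendsTo : {A : Set} → (P Q : ℕ → Pred A 0ℓ) → ℚ → Set
RatioTendsTo P Q l =
  ∀ ε → 0ℚ ℚ.< ε →
  ∃[ n₀ ] ∀ n → n₀ ℕ.≤ n →
  ∀ p q → HasCardinality (P n) p → HasCardinality (Q n) q →
  Σ[ q≢0 ∈ NonZero q ] ∣ _/_ (+ p) q {{q≢0}} - l ∣ ℚ.< ε

cardinality-unique : {A : Set} {P : Pred A 0ℓ} {j k : ℕ} →
                     HasCardinality P j → HasCardinality P k → j ≡ k
cardinality-unique (xs , xs! , xs⇔P , refl) (ys , ys! , ys⇔P , refl) =
  ↭-length (∼bag⇒↭ (unique∧set⇒bag xs! ys! (λ {a} → ⇔-sym (ys⇔P a) ⇔-∘ xs⇔P a)))

private
  ¬¬-comprehension : {A : Set} (P : Pred A 0ℓ) (xs : List A) →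
    ¬ ¬ (∃[ ys ] Unique ys × (∀ a → a ∈ ys ⇔ (a ∈ xs × P a)))
  ¬¬-comprehension P [] k = k ([] , [] , λ a → mk⇔ (λ ()) (λ ()))
  ¬¬-comprehension {A} P (x ∷ xs) k =
    ¬¬-comprehension P xs λ (ys , ys! , ys⇔) →
    ¬¬-excluded-middle λ P? →
    ¬¬-excluded-middle λ ∈? → k (extend ys ys! ys⇔ P? ∈?)
    where
    extend : ∀ ys → Unique ys → (∀ a → a ∈ ys ⇔ (a ∈ xs × P a)) →
             Dec (P x) → Dec (x ∈ ys) →
             ∃[ zs ] Unique zs × (∀ a → a ∈ zs ⇔ (a ∈ x ∷ xs × P a))
    extend ys ys! ys⇔ (no ¬px) _ = ys , ys! , λ a → mk⇔
      (λ a∈ → let a∈xs , pa = Equivalence.to (ys⇔ a) a∈ in there a∈xs , pa)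
      (λ { (here refl , pa) → contradiction pa ¬px
         ; (there a∈ , pa) → Equivalence.from (ys⇔ a) (a∈ , pa) })
    extend ys ys! ys⇔ (yes px) (yes x∈) = ys , ys! , λ a → mk⇔
      (λ a∈ → let a∈xs , pa = Equivalence.to (ys⇔ a) a∈ in there a∈xs , pa)
      (λ { (here refl , pa) → x∈
         ; (there a∈ , pa) → Equivalence.from (ys⇔ a) (a∈ , pa) })
    extend ys ys! ys⇔ (yes px) (no x∉) =
      x ∷ ys , All.tabulate (λ { a∈ refl → x∉ a∈ }) ∷ ys! , λ a → mk⇔
      (λ { (here refl) → here refl , px
         ; (there a∈) → let a∈xs , pa = Equivalence.to (ys⇔ a) a∈ in there a∈xs , pa })
      (λ { (here refl , pa) → here refl
         ; (there a∈ , pa) → there (Equivalence.from (ys⇔ a) (a∈ , pa)) })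

  module _ {ℬ : Basis} where
    open Basis ℬ

    upToHeight : ℕ → List (Combinator ℬ)
    upToHeight zero    = map prim (allFin #prims)
    upToHeight (suc d) =
      map prim (allFin #prims) ++ cartesianProductWith _·_ (upToHeight d) (upToHeight d)

    ∈-upToHeight : ∀ d (P : Combinator ℬ) → size P ℕ.≤ d → P ∈ upToHeight d
    ∈-upToHeight zero    (prim X) _       = ∈-map⁺ prim (∈-allFin X)
    ∈-upToHeight (suc d) (prim X) _       = ∈-++⁺ˡ (∈-map⁺ prim (∈-allFin X))
    ∈-upToHeight (suc d) (P · Q)  (s≤s h) =
      ∈-++⁺ʳ (map prim (allFin #prims)) (∈-cartesianProductWith⁺ _·_
        (∈-upToHeight d P (≤-trans (m≤m+n (size P) (size Q)) h))
        (∈-upToHeight d Q (≤-trans (m≤n+m (size Q) (size P)) h)))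

cardinality-exists : {ℬ : Basis} (R : Pred (Combinator ℬ) 0ℓ) (n : ℕ) →
  ¬ ¬ (∃[ k ] HasCardinality (λ P → size P ≡ n × R P) k)
cardinality-exists R n k =
  ¬¬-comprehension (λ P → size P ≡ n × R P) (upToHeight n) λ (ys , ys! , ys⇔) →
  k (length ys , ys , ys! , (λ P → mk⇔
    (λ P∈ → proj₂ (Equivalence.to (ys⇔ P) P∈))
    (λ r → Equivalence.from (ys⇔ P) (∈-upToHeight n P (≤-reflexive (proj₁ r)) , r))) , refl)

{-# OPTIONS --safe #-}

-- Write T m for the number of combinators of size m. By confluence K x y reduces to x, so
-- K X Q is weakly normalising for a primitive X and every combinator Q whatsoever; hence
-- T (n − c) of the combinators of size n are weakly normalising, for a constant c.
-- Likewise ω ω (ω = S I I) yields a divergent combinator Ω, and only combinators without a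
-- subterm P Ω can be strongly normalising. In such a combinator of size n there are n + 1
-- ways to replace a leaf X by X Ω, and each result determines the original, so
-- there are at most T (n + d) / (n + 1) of them, for a constant d. Since T (m + 1) ≤ C T m,
-- they are a fraction O(1/n) of the weakly normalising combinators of size n.

module Submission where

open import Defs
open import Data.Fin.Base using (Fin)
open import Data.Fin.Patterns using (0F; 1F; 2F)
import Data.Fin.Properties as Fin
open import Data.Integer.Base as ℤ using (+_; +<+)
import Data.Integer.Properties as ℤ
import Data.Integer.Tactic.RingSolver as ℤ
open import Data.List.Base
  using (List; []; _∷_; [_]; _++_; length; map; concatMap; allFin; cartesianProductWith; filter)
open import Data.List.Membership.Propositional using (_∈_)
open import Data.List.Membership.Propositional.Properties
open import Data.List.Properties using (length-map; length-++; length-tabulate)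
open import Data.List.Relation.Binary.Disjoint.Propositional using (Disjoint)
open import Data.List.Relation.Binary.Subset.Propositional using (_⊆_)
open import Data.List.Relation.Unary.All as All using (All; []; _∷_)
import Data.List.Relation.Unary.All.Properties as All
open import Data.List.Relation.Unary.AllPairs using ([]; _∷_)
open import Data.List.Relation.Unary.Any using (here; there)
open import Data.List.Relation.Unary.Unique.Propositional using (Unique)
import Data.List.Relation.Unary.Unique.Propositional.Properties as Unique
open import Data.Maybe.Base using (Maybe; just; nothing)
open import Data.Maybe.Properties using (just-injective)
open import Data.Nat.Base
  using (ℕ; zero; suc; _+_; _*_; _∸_; _^_; _≤_; _<_; z≤n; s≤s; NonZero; ≢-nonZero⁻¹; >-nonZero; >-nonZero⁻¹)
open import Data.Nat.Properties hiding (_≟_)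
open import Data.Nat.Tactic.RingSolver using (solve-∀)
open import Data.Product using (∃; ∃-syntax; Σ-syntax; _×_; _,_; proj₁; proj₂)
open import Data.Rational.Base as ℚ using (ℚ; mkℚ; 0ℚ; 1ℚ; _/_; _-_; ∣_∣; toℚᵘ)
import Data.Rational.Properties as ℚ
open import Data.Rational.Unnormalised.Base as ℚᵘ using (mkℚᵘ; *≡*; *<*)
import Data.Rational.Unnormalised.Properties as ℚᵘ
open import Data.Sum.Base using (_⊎_; inj₁; inj₂)
open import Data.Vec.Base as Vec using (Vec; []; _∷_)
open import Data.Vec.Properties using (lookup-map)
open import Data.Vec.Relation.Binary.Pointwise.Inductive as Pointwise using (Pointwise; []; _∷_)
import Data.Vec.Relation.Unary.All as VecAll
open import Function.Bundles using (Equivalence)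
open import Relation.Binary.Construct.Closure.ReflexiveTransitive using (Star; ε; _◅_; _◅◅_; gmap; kleisliStar)
open import Relation.Binary.Definitions using (DecidableEquality)
open import Relation.Binary.PropositionalEquality
  using (_≡_; _≢_; refl; sym; trans; cong; cong₂; subst; module ≡-Reasoning)
open import Relation.Binary.Rewriting using (IsNormalForm; Confluent; conf⇒nf)
open import Relation.Nullary using (¬_; Dec; yes; no)
open import Relation.Nullary.Decidable using (map′; ¬?; _⊎-dec_; _×-dec_)
open import Relation.Nullary.Negation using (contradiction)

-- Growth of the number of combinators

-- The number of forests of k binary trees with n internal nodes and b-coloured leaves;
-- the second case of the last clause splits the first tree at its root.
forestCount : ℕ → ℕ → ℕ → ℕ
forestCount b zero    zero    = 1
forestCount b (suc n) zero    = 0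
forestCount b zero    (suc k) = b * forestCount b zero k
forestCount b (suc n) (suc k) = b * forestCount b (suc n) k + forestCount b n (suc (suc k))

-- Inductive step of `forestCount-ratio`, with `a`, `c`, `d`, `e` the counts at (n+1, k), (n, k+2),
-- (n, k+3), (n+1, k+1). As `e = b * a + c`, the lower bound on the share of `a` in `e` caps the
-- share of `c`, and `d` is bounded through `c`.
ratio-step : ∀ b k a c d → let e = b * a + c in
  k * e ≤ 2 * b * suc k * a →
  suc (suc k) * d ≤ 2 * b * suc (suc (suc k)) * c →
  suc k * (b * e + d) ≤ 2 * b * suc (suc k) * e
ratio-step b k a c d ke≤ d≤ = begin
  suc k * (b * e + d)                       ≡⟨ lemma₁ b k d e ⟩
  b * suc k * e + suc k * d                 ≤⟨ +-monoʳ-≤ (b * suc k * e) (*-cancelˡ-≤ (suc (suc k)) bound) ⟩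
  b * suc k * e + b * suc (suc (suc k)) * e ≡⟨ lemma₅ b k e ⟩
  2 * b * suc (suc k) * e                   ∎
  where
  open ≤-Reasoning
  e = b * a + c
  lemma₁ : ∀ b k d e → suc k * (b * e + d) ≡ b * suc k * e + suc k * d
  lemma₁ = solve-∀
  lemma₂ : ∀ b k c → suc k * (2 * b * suc (suc (suc k)) * c) ≡ b * suc (suc (suc k)) * (2 * suc k * c)
  lemma₂ = solve-∀
  lemma₃ : ∀ b k a c → 2 * suc k * c + 2 * b * suc k * a ≡ suc (suc k) * (b * a + c) + k * (b * a + c)
  lemma₃ = solve-∀
  lemma₄ : ∀ b k e → b * suc (suc (suc k)) * (suc (suc k) * e) ≡ suc (suc k) * (b * suc (suc (suc k)) * e)
  lemma₄ = solve-∀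
  lemma₅ : ∀ b k e → b * suc k * e + b * suc (suc (suc k)) * e ≡ 2 * b * suc (suc k) * e
  lemma₅ = solve-∀
  swap : ∀ x y z → x * (y * z) ≡ y * (x * z)
  swap = solve-∀
  c-bound : 2 * suc k * c ≤ suc (suc k) * e
  c-bound = +-cancelʳ-≤ (k * e) _ _ (begin
    2 * suc k * c + k * e             ≤⟨ +-monoʳ-≤ (2 * suc k * c) ke≤ ⟩
    2 * suc k * c + 2 * b * suc k * a ≡⟨ lemma₃ b k a c ⟩
    suc (suc k) * e + k * e           ∎)
  bound : suc (suc k) * (suc k * d) ≤ suc (suc k) * (b * suc (suc (suc k)) * e)
  bound = begin
    suc (suc k) * (suc k * d)                     ≡⟨ swap (suc (suc k)) (suc k) d ⟩
    suc k * (suc (suc k) * d)                     ≤⟨ *-monoʳ-≤ (suc k) d≤ ⟩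
    suc k * (2 * b * suc (suc (suc k)) * c)       ≡⟨ lemma₂ b k c ⟩
    b * suc (suc (suc k)) * (2 * suc k * c)       ≤⟨ *-monoʳ-≤ (b * suc (suc (suc k))) c-bound ⟩
    b * suc (suc (suc k)) * (suc (suc k) * e)     ≡⟨ lemma₄ b k e ⟩
    suc (suc k) * (b * suc (suc (suc k)) * e)     ∎

-- The exact ratio is b(k+1)(2n+k) / k(n+k+1); this bound is its supremum over n.
forestCount-ratio : ∀ b n k → k * forestCount b n (suc k) ≤ 2 * b * suc k * forestCount b n k
forestCount-ratio b n zero = z≤n
forestCount-ratio b zero (suc k) = begin
  suc k * (b * t)             ≤⟨ m≤m+n _ _ ⟩
  suc k * (b * t) + (k + 3) * b * t ≡⟨ lemma b k t ⟩
  2 * b * suc (suc k) * t     ∎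
  where
  open ≤-Reasoning
  t = forestCount b zero (suc k)
  lemma : ∀ b k t → suc k * (b * t) + (k + 3) * b * t ≡ 2 * b * suc (suc k) * t
  lemma = solve-∀
forestCount-ratio b (suc n) (suc k) =
  ratio-step b k (forestCount b (suc n) k) (forestCount b n (suc (suc k))) (forestCount b n (suc (suc (suc k))))
    (forestCount-ratio b (suc n) k) (forestCount-ratio b n (suc (suc k)))

-- The Catalan number of `n` times `b ^ suc n`.
treeCount : ℕ → ℕ → ℕ
treeCount b n = forestCount b n 1

-- Splitting at the root turns a tree into a pair of trees with one node fewer in total; the ratio
-- bound for `k = 1` compares pairs with single trees.
treeCount-step : ∀ b n → treeCount b (suc n) ≤ 4 * b * treeCount b n
treeCount-step b n = begin
  b * 0 + forestCount b n 2        ≡⟨ lemma₁ b (forestCount b n 2) ⟩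
  1 * forestCount b n 2            ≤⟨ forestCount-ratio b n 1 ⟩
  2 * b * 2 * forestCount b n 1    ≡⟨ lemma₂ b (forestCount b n 1) ⟩
  4 * b * forestCount b n 1        ∎
  where
  open ≤-Reasoning
  lemma₁ : ∀ b x → b * 0 + x ≡ 1 * x
  lemma₁ = solve-∀
  lemma₂ : ∀ b x → 2 * b * 2 * x ≡ 4 * b * x
  lemma₂ = solve-∀

treeCount-growth : ∀ b i n → treeCount b (i + n) ≤ (4 * b) ^ i * treeCount b n
treeCount-growth b zero    n = ≤-reflexive (sym (*-identityˡ _))
treeCount-growth b (suc i) n = begin
  treeCount b (suc (i + n))               ≤⟨ treeCount-step b (i + n) ⟩
  4 * b * treeCount b (i + n)             ≤⟨ *-monoʳ-≤ (4 * b) (treeCount-growth b i n) ⟩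
  4 * b * ((4 * b) ^ i * treeCount b n)   ≡⟨ *-assoc (4 * b) _ _ ⟨
  (4 * b) ^ suc i * treeCount b n         ∎
  where open ≤-Reasoning

module _ {A : Set} where

  -- Deleting `x` from `ys` keeps the rest of `xs`, whose members differ from `x`. The comparisons
  -- of cardinalities below rest on this.
  Unique-⊆⇒length-≤ : {xs ys : List A} → Unique xs → xs ⊆ ys → length xs ≤ length ys
  Unique-⊆⇒length-≤ []          sub = z≤n
  Unique-⊆⇒length-≤ {x ∷ xs} (x∉ ∷ xs!) sub with as , bs , refl ← ∈-∃++ (sub (here refl)) = begin
    suc (length xs)              ≤⟨ s≤s (Unique-⊆⇒length-≤ xs! sub′) ⟩
    suc (length (as ++ bs))      ≡⟨ cong suc (length-++ as) ⟩
    suc (length as + length bs)  ≡⟨ +-suc (length as) (length bs) ⟨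
    length as + suc (length bs)  ≡⟨ length-++ as ⟨
    length (as ++ x ∷ bs)        ∎
    where
    open ≤-Reasoning
    sub′ : xs ⊆ as ++ bs
    sub′ y∈ with ∈-++⁻ as (sub (there y∈))
    ... | inj₁ y∈as         = ∈-++⁺ˡ y∈as
    ... | inj₂ (here refl)  = contradiction refl (All.lookup x∉ y∈)
    ... | inj₂ (there y∈bs) = ∈-++⁺ʳ as y∈bs

length-cartesianProductWith : {A B C : Set} (f : A → B → C) (xs : List A) (ys : List B) →
                              length (cartesianProductWith f xs ys) ≡ length xs * length ys
length-cartesianProductWith f []       ys = refl
length-cartesianProductWith f (x ∷ xs) ys = trans (length-++ (map (f x) ys))
  (cong₂ _+_ (length-map (f x) ys) (length-cartesianProductWith f xs ys))

-- Enumeration of the combinators of each size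

module _ {ℬ : Basis} where
  open Basis ℬ

  private variable
    k n : ℕ
    D P Q : Combinator ℬ

  joinFirstTwo : Vec (Combinator ℬ) (suc (suc k)) → Vec (Combinator ℬ) (suc k)
  joinFirstTwo (P ∷ Q ∷ Ps) = P · Q ∷ Ps

  joinFirstTwo-injective : {Ps Qs : Vec (Combinator ℬ) (suc (suc k))} →
                           joinFirstTwo Ps ≡ joinFirstTwo Qs → Ps ≡ Qs
  joinFirstTwo-injective {Ps = _ ∷ _ ∷ _} {_ ∷ _ ∷ _} refl = refl

  prependPrims : List (Vec (Combinator ℬ) k) → List (Vec (Combinator ℬ) (suc k))
  prependPrims = cartesianProductWith (λ X Ps → prim X ∷ Ps) (allFin #prims)

  -- Follows the clauses of `forestCount`, so that the lengths agree by construction. Forests in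
  -- place of single trees make the recursion structural, lexicographically in `n` and `k`.
  forests : (n k : ℕ) → List (Vec (Combinator ℬ) k)
  forests zero    zero    = [ [] ]
  forests (suc n) zero    = []
  forests zero    (suc k) = prependPrims (forests zero k)
  forests (suc n) (suc k) = prependPrims (forests (suc n) k) ++ map joinFirstTwo (forests n (suc (suc k)))

  totalSize : Vec (Combinator ℬ) k → ℕ
  totalSize []       = 0
  totalSize (P ∷ Ps) = size P + totalSize Ps

  length-prependPrims : (Pss : List (Vec (Combinator ℬ) k)) → length (prependPrims Pss) ≡ #prims * length Pss
  length-prependPrims Pss = trans (length-cartesianProductWith _ (allFin #prims) Pss)
    (cong (_* length Pss) (length-tabulate {n = #prims} (λ X → X)))

  length-forests : ∀ n k → length (forests n k) ≡ forestCount #prims n k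
  length-forests zero    zero    = refl
  length-forests (suc n) zero    = refl
  length-forests zero    (suc k) = trans (length-prependPrims (forests zero k))
    (cong (#prims *_) (length-forests zero k))
  length-forests (suc n) (suc k) = trans (length-++ (prependPrims (forests (suc n) k)))
    (cong₂ _+_ (trans (length-prependPrims (forests (suc n) k)) (cong (#prims *_) (length-forests (suc n) k)))
               (trans (length-map joinFirstTwo (forests n (suc (suc k)))) (length-forests n (suc (suc k)))))

  ∈-prependPrims : ∀ X {Ps : Vec (Combinator ℬ) k} {Pss} → Ps ∈ Pss → prim X ∷ Ps ∈ prependPrims Pss
  ∈-prependPrims X = ∈-cartesianProductWith⁺ _ (∈-allFin X)

  ∈-forests : ∀ n k (Ps : Vec (Combinator ℬ) k) → totalSize Ps ≡ n → Ps ∈ forests n k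
  ∈-forests zero    zero    []            _  = here refl
  ∈-forests zero    (suc k) (prim X ∷ Ps) eq = ∈-prependPrims X (∈-forests zero k Ps eq)
  ∈-forests (suc n) (suc k) (prim X ∷ Ps) eq = ∈-++⁺ˡ (∈-prependPrims X (∈-forests (suc n) k Ps eq))
  ∈-forests (suc n) (suc k) (P · Q ∷ Ps)  eq = ∈-++⁺ʳ (prependPrims (forests (suc n) k)) (∈-map⁺ joinFirstTwo
    (∈-forests n (suc (suc k)) (P ∷ Q ∷ Ps) (trans (sym (+-assoc (size P) (size Q) _)) (suc-injective eq))))

  ∈-prependPrims⁻ : (Pss : List (Vec (Combinator ℬ) k)) {Ps : Vec (Combinator ℬ) (suc k)} → Ps ∈ prependPrims Pss →
                    ∃[ X ] ∃[ Qs ] Qs ∈ Pss × Ps ≡ prim X ∷ Qs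
  ∈-prependPrims⁻ Pss Ps∈
    with X , Qs , _ , Qs∈ , eq ← ∈-cartesianProductWith⁻ _ (allFin #prims) Pss Ps∈
    = X , Qs , Qs∈ , eq

  prependPrims-totalSize : {Pss : List (Vec (Combinator ℬ) k)} → All (λ Ps → totalSize Ps ≡ n) Pss →
                           All (λ Ps → totalSize Ps ≡ n) (prependPrims Pss)
  prependPrims-totalSize {Pss = Pss} sizes = All.tabulate λ Ps∈ → lemma (∈-prependPrims⁻ Pss Ps∈)
    where
    lemma : ∀ {Ps} → ∃[ X ] ∃[ Qs ] Qs ∈ Pss × Ps ≡ prim X ∷ Qs → totalSize Ps ≡ _
    lemma (_ , _ , Qs∈ , refl) = All.lookup sizes Qs∈

  forests-totalSize : ∀ n k → All (λ Ps → totalSize Ps ≡ n) (forests n k)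
  forests-totalSize zero    zero    = refl ∷ []
  forests-totalSize (suc n) zero    = []
  forests-totalSize zero    (suc k) = prependPrims-totalSize (forests-totalSize zero k)
  forests-totalSize (suc n) (suc k) = All.++⁺ (prependPrims-totalSize (forests-totalSize (suc n) k))
    (All.map⁺ (All.map (λ {Ps} → joined Ps) (forests-totalSize n (suc (suc k)))))
    where
    joined : (Ps : Vec (Combinator ℬ) (suc (suc k))) → totalSize Ps ≡ n → totalSize (joinFirstTwo Ps) ≡ suc n
    joined (P ∷ Q ∷ Ps) eq = cong suc (trans (+-assoc (size P) (size Q) (totalSize Ps)) eq)

  prependPrims-unique : {Pss : List (Vec (Combinator ℬ) k)} → Unique Pss → Unique (prependPrims Pss)
  prependPrims-unique = Unique.cartesianProductWith⁺ _ (λ { refl → refl , refl }) (Unique.allFin⁺ #prims)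

  forests-unique : ∀ n k → Unique (forests n k)
  forests-unique zero    zero    = [] ∷ []
  forests-unique (suc n) zero    = []
  forests-unique zero    (suc k) = prependPrims-unique (forests-unique zero k)
  forests-unique (suc n) (suc k) = Unique.++⁺ (prependPrims-unique (forests-unique (suc n) k))
    (Unique.map⁺ joinFirstTwo-injective (forests-unique n (suc (suc k)))) disjoint
    where
    disjoint : Disjoint (prependPrims (forests (suc n) k)) (map joinFirstTwo (forests n (suc (suc k))))
    disjoint (Ps∈ˡ , Ps∈ʳ) with _ , _ , _ , refl ← ∈-prependPrims⁻ (forests (suc n) k) Ps∈ˡ
                           with _ ∷ _ ∷ _ , _ , () ← ∈-map⁻ joinFirstTwo Ps∈ʳ

  ofSize : ℕ → List (Combinator ℬ)
  ofSize n = map Vec.head (forests n 1)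

  length-ofSize : ∀ n → length (ofSize n) ≡ treeCount #prims n
  length-ofSize n = trans (length-map Vec.head (forests n 1)) (length-forests n 1)

  ∈-ofSize : ∀ P → size P ≡ n → P ∈ ofSize n
  ∈-ofSize {n} P refl = ∈-map⁺ Vec.head (∈-forests n 1 (P ∷ []) (+-identityʳ (size P)))

  ofSize-size : ∀ n → P ∈ ofSize n → size P ≡ n
  ofSize-size n P∈ with Q ∷ [] , Q∈ , refl ← ∈-map⁻ Vec.head P∈
    = trans (sym (+-identityʳ (size Q))) (All.lookup (forests-totalSize n 1) Q∈)

  ofSize-unique : ∀ n → Unique (ofSize n)
  ofSize-unique n = Unique.map⁺ (λ { {_ ∷ []} {_ ∷ []} refl → refl }) (forests-unique n 1)

  -- Marking a leaf with a fixed argument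

  infix 4 _≟_

  _≟_ : DecidableEquality (Combinator ℬ)
  prim X  ≟ prim Y    = map′ (cong prim) (λ { refl → refl }) (X Fin.≟ Y)
  prim X  ≟ (R · S)   = no λ ()
  (P · Q) ≟ prim Y    = no λ ()
  (P · Q) ≟ (R · S)   = map′ (λ { (refl , refl) → refl }) (λ { refl → refl , refl }) (P ≟ R ×-dec Q ≟ S)

  -- Only occurrences as a right operand count, since these are the ones that `unmark` looks for;
  -- the root and function positions do not qualify.
  data HasArgument (D : Combinator ℬ) : Combinator ℬ → Set where
    here  : HasArgument D (P · D)
    left  : HasArgument D P → HasArgument D (P · Q)
    right : HasArgument D Q → HasArgument D (P · Q)

  hasArgument? : ∀ D P → Dec (HasArgument D P)
  hasArgument? D (prim X) = no λ ()
  hasArgument? D (P · Q)  = map′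
    (λ { (inj₁ refl) → here ; (inj₂ (inj₁ p)) → left p ; (inj₂ (inj₂ q)) → right q })
    (λ { here → inj₁ refl ; (left p) → inj₂ (inj₁ p) ; (right q) → inj₂ (inj₂ q) })
    (Q ≟ D ⊎-dec (hasArgument? D P ⊎-dec hasArgument? D Q))

  marks : Combinator ℬ → Combinator ℬ → List (Combinator ℬ)
  marks D (prim X) = [ prim X · D ]
  marks D (P · Q)  = map (_· Q) (marks D P) ++ map (P ·_) (marks D Q)

  -- There is one mark per leaf, and a binary tree has one leaf more than internal nodes.
  length-marks : ∀ D P → length (marks D P) ≡ suc (size P)
  length-marks D (prim X) = refl
  length-marks D (P · Q)  = begin
    length (map (_· Q) (marks D P) ++ map (P ·_) (marks D Q))          ≡⟨ length-++ (map (_· Q) (marks D P)) ⟩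
    length (map (_· Q) (marks D P)) + length (map (P ·_) (marks D Q))
      ≡⟨ cong₂ _+_ (length-map _ (marks D P)) (length-map _ (marks D Q)) ⟩
    length (marks D P) + length (marks D Q)
      ≡⟨ cong₂ _+_ (length-marks D P) (length-marks D Q) ⟩
    suc (size P + suc (size Q))                                        ≡⟨ cong suc (+-suc (size P) (size Q)) ⟩
    suc (suc (size P + size Q))                                        ∎
    where open ≡-Reasoning

  ∈-marks-· : ∀ D P Q {R} → R ∈ marks D (P · Q) →
              (∃[ P′ ] P′ ∈ marks D P × R ≡ P′ · Q) ⊎ (∃[ Q′ ] Q′ ∈ marks D Q × R ≡ P · Q′)
  ∈-marks-· D P Q R∈ with ∈-++⁻ (map (_· Q) (marks D P)) R∈
  ... | inj₁ R∈ˡ = inj₁ (∈-map⁻ (_· Q) R∈ˡ)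
  ... | inj₂ R∈ʳ = inj₂ (∈-map⁻ (P ·_) R∈ʳ)

  size-marks : ∀ D P → Q ∈ marks D P → size Q ≡ suc (size D) + size P
  size-marks D (prim X) (here refl) = cong suc (sym (+-identityʳ (size D)))
  size-marks D (P · Q) R∈ with ∈-marks-· D P Q R∈
  ... | inj₁ (P′ , P′∈ , refl) = cong suc (begin
    size P′ + size Q                    ≡⟨ cong (_+ size Q) (size-marks D P P′∈) ⟩
    suc (size D + size P + size Q)      ≡⟨ cong suc (+-assoc (size D) (size P) (size Q)) ⟩
    suc (size D + (size P + size Q))    ≡⟨ +-suc (size D) (size P + size Q) ⟨
    size D + suc (size P + size Q)      ∎)
    where open ≡-Reasoning
  ... | inj₂ (Q′ , Q′∈ , refl) = cong suc (begin
    size P + size Q′                    ≡⟨ cong (λ s → size P + s) (size-marks D Q Q′∈) ⟩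
    size P + suc (size D + size Q)      ≡⟨ +-suc (size P) (size D + size Q) ⟩
    suc (size P + (size D + size Q))    ≡⟨ cong suc (+-assoc (size P) (size D) (size Q)) ⟨
    suc (size P + size D + size Q)      ≡⟨ cong (λ s → suc (s + size Q)) (+-comm (size P) (size D)) ⟩
    suc (size D + size P + size Q)      ≡⟨ cong suc (+-assoc (size D) (size P) (size Q)) ⟩
    suc (size D + (size P + size Q))    ≡⟨ +-suc (size D) (size P + size Q) ⟨
    size D + suc (size P + size Q)      ∎)
    where open ≡-Reasoning

  marks-≢ : ∀ D P → ¬ P ∈ marks D P
  marks-≢ D P P∈ = m≢1+n+m (size P) (size-marks D P P∈)

  marks-≢-D : ∀ D P → ¬ D ∈ marks D P
  marks-≢-D D P D∈ = m≢1+m+n (size D) (size-marks D P D∈)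

  marks-unique : ∀ D P → Unique (marks D P)
  marks-unique D (prim X) = [] ∷ []
  marks-unique D (P · Q)  = Unique.++⁺
    (Unique.map⁺ (λ { refl → refl }) (marks-unique D P))
    (Unique.map⁺ (λ { refl → refl }) (marks-unique D Q)) disjoint
    where
    disjoint : Disjoint (map (_· Q) (marks D P)) (map (P ·_) (marks D Q))
    disjoint (R∈ˡ , R∈ʳ) with _ , P∈ , refl ← ∈-map⁻ (_· Q) R∈ˡ
                         with _ , _ , refl ← ∈-map⁻ (P ·_) R∈ʳ = marks-≢ D P P∈

  -- Meant for terms with a single mark: once the argument `D` is found, the function part is
  -- returned without further search.
  unmark : Combinator ℬ → Combinator ℬ → Combinator ℬ
  unmark D (prim X) = prim X
  unmark D (P · Q) with Q ≟ D
  ... | yes _ = P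
  ... | no  _ = unmark D P · unmark D Q

  unmark-unmarked : ∀ P → ¬ HasArgument D P → unmark D P ≡ P
  unmark-unmarked (prim X) _ = refl
  unmark-unmarked {D} (P · Q) ¬D with Q ≟ D
  ... | yes refl = contradiction here ¬D
  ... | no  _    = cong₂ _·_ (unmark-unmarked P (λ d → ¬D (left d))) (unmark-unmarked Q (λ d → ¬D (right d)))

  -- The inserted `D` is the only argument `D` of the marked term: the original has none, and an
  -- argument containing the mark is too large to equal `D`.
  unmark-marks : ∀ P → ¬ HasArgument D P → Q ∈ marks D P → unmark D Q ≡ P
  unmark-marks {D} (prim X) _ (here refl) with D ≟ D
  ... | yes _   = refl
  ... | no  D≢D = contradiction refl D≢D
  unmark-marks {D} (P · Q) ¬D R∈ with ∈-marks-· D P Q R∈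
  ... | inj₁ (P′ , P′∈ , refl) with Q ≟ D
  ...   | yes refl = contradiction here ¬D
  ...   | no  _    = cong₂ _·_ (unmark-marks P (λ d → ¬D (left d)) P′∈) (unmark-unmarked Q (λ d → ¬D (right d)))
  unmark-marks {D} (P · Q) ¬D R∈ | inj₂ (Q′ , Q′∈ , refl) with Q′ ≟ D
  ...   | yes refl = contradiction Q′∈ (marks-≢-D D Q)
  ...   | no  _    = cong₂ _·_ (unmark-unmarked P (λ d → ¬D (left d))) (unmark-marks Q (λ d → ¬D (right d)) Q′∈)

  private
    Unmarked : Combinator ℬ → ℕ → Combinator ℬ → Set
    Unmarked D n P = size P ≡ n × ¬ HasArgument D P

  length-allMarks : ∀ {Ps} → All (Unmarked D n) Ps → length (concatMap (marks D) Ps) ≡ length Ps * suc n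
  length-allMarks []                        = refl
  length-allMarks {D} (_∷_ {P} (refl , _) ps) = trans (length-++ (marks D P))
    (cong₂ _+_ (length-marks D P) (length-allMarks ps))

  ∈-allMarks⁻ : ∀ {Ps} → All (Unmarked D n) Ps → Q ∈ concatMap (marks D) Ps →
                unmark D Q ∈ Ps × size Q ≡ suc (size D) + n
  ∈-allMarks⁻ {D} {Ps = P ∷ Ps} ((refl , ¬D) ∷ ps) Q∈ with ∈-++⁻ (marks D P) Q∈
  ... | inj₁ Q∈P  = here (unmark-marks P ¬D Q∈P) , size-marks D P Q∈P
  ... | inj₂ Q∈Ps with ∈Ps , sz ← ∈-allMarks⁻ ps Q∈Ps = there ∈Ps , sz

  -- `unmark` recovers the original from any of its marks, so different originals have disjoint
  -- lists of marks.
  allMarks-unique : ∀ {Ps} → All (Unmarked D n) Ps → Unique Ps → Unique (concatMap (marks D) Ps)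
  allMarks-unique [] [] = []
  allMarks-unique {D} (_∷_ {P} {Ps} (_ , ¬D) ps) (P∉ ∷ Ps!) = Unique.++⁺ (marks-unique D P) (allMarks-unique ps Ps!)
    λ (Q∈P , Q∈Ps) → All.lookup P∉ (subst (_∈ Ps) (unmark-marks P ¬D Q∈P) (proj₁ (∈-allMarks⁻ ps Q∈Ps))) refl

  unmarked-bound : ∀ {Ps} → All (Unmarked D n) Ps → Unique Ps →
                   length Ps * suc n ≤ treeCount #prims (suc (size D) + n)
  unmarked-bound {D} {n} {Ps} ps Ps! = begin
    length Ps * suc n                        ≡⟨ length-allMarks ps ⟨
    length (concatMap (marks D) Ps)          ≤⟨ Unique-⊆⇒length-≤ (allMarks-unique ps Ps!)
                                                  (λ Q∈ → ∈-ofSize _ (proj₂ (∈-allMarks⁻ ps Q∈))) ⟩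
    length (ofSize (suc (size D) + n))       ≡⟨ length-ofSize (suc (size D) + n) ⟩
    treeCount #prims (suc (size D) + n)      ∎
    where open ≤-Reasoning

-- Confluence and divergence

module _ {ℬ : Basis} where
  open Basis ℬ

  private variable
    V W : Set
    m n k : ℕ
    P P′ Q Q′ R : Term ℬ V
    Ns Ms : Vec (Term ℬ V) m

  infix 4 _⟶*_ _⇛_

  _⟶*_ : Term ℬ V → Term ℬ V → Set
  _⟶*_ = Star _⟶_

  ·-cong-⟶* : P ⟶* P′ → Q ⟶* Q′ → P · Q ⟶* P′ · Q′
  ·-cong-⟶* {Q = Q} rs ss = gmap (_· Q) appˡ rs ◅◅ gmap (_ ·_) appʳ ss

  ·*-cong-⟶* : P ⟶* P′ → Pointwise _⟶*_ Ns Ms → P ·* Ns ⟶* P′ ·* Ms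
  ·*-cong-⟶* rs []         = rs
  ·*-cong-⟶* rs (ss ∷ sss) = ·*-cong-⟶* (·-cong-⟶* rs ss) sss

  -- `Lacks k P`: P is a primitive applied to k arguments fewer than its arity.
  data Lacks {V : Set} : ℕ → Term ℬ V → Set where
    prim : ∀ X → Lacks (arity X) (prim X)
    app  : {P Q : Term ℬ V} → Lacks (suc k) P → Lacks k (P · Q)

  Lacks-unique : Lacks m P → Lacks n P → m ≡ n
  Lacks-unique (prim X) (prim .X) = refl
  Lacks-unique (app l)  (app l′)  = suc-injective (Lacks-unique l l′)

  Lacks-·* : (Ns : Vec (Term ℬ V) m) → Lacks m P → Lacks 0 (P ·* Ns)
  Lacks-·* []       l = l
  Lacks-·* (N ∷ Ns) l = Lacks-·* Ns (app l)

  redex-saturated : ∀ X (Ns : Vec (Term ℬ V) (arity X)) → P ≡ prim X ·* Ns → Lacks 0 P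
  redex-saturated X Ns refl = Lacks-·* Ns (prim X)

  head : Term ℬ V → Maybe Primitive
  head (prim X) = just X
  head (var x)  = nothing
  head (P · Q)  = head P

  head-·* : (P : Term ℬ V) (Ns : Vec (Term ℬ V) m) → head (P ·* Ns) ≡ head P
  head-·* P []       = refl
  head-·* P (N ∷ Ns) = head-·* (P · N) Ns

  ·*-injective : (Ns Ms : Vec (Term ℬ V) m) → P ·* Ns ≡ Q ·* Ms → P ≡ Q × Ns ≡ Ms
  ·*-injective []       []       eq = eq , refl
  ·*-injective (N ∷ Ns) (M ∷ Ms) eq with refl , refl ← ·*-injective Ns Ms eq = refl , refl

  -- Equality of the pairs (`X`, `Ns`) and (`Y`, `Ms`) as an inductive family, because the length of
  -- the vector depends on the primitive.
  data SameArgs {V : Set} {X : Primitive} (Ns : Vec (Term ℬ V) (arity X)) :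
                (Y : Primitive) → Vec (Term ℬ V) (arity Y) → Set where
    same : SameArgs Ns X Ns

  redex-injective : ∀ X Y (Ns : Vec (Term ℬ V) (arity X)) (Ms : Vec (Term ℬ V) (arity Y)) →
                    prim X ·* Ns ≡ prim Y ·* Ms → SameArgs Ns Y Ms
  redex-injective X Y Ns Ms eq
    with refl ← just-injective (trans (sym (head-·* (prim X) Ns)) (trans (cong head eq) (head-·* (prim Y) Ms)))
    with _ , refl ← ·*-injective Ns Ms eq
    = same

  -- Parallel reduction in the style of Tait and Martin-Löf. `contract` carries an equation for `P`,
  -- since an index of the form `prim X ·* Ns` would obstruct case analysis on derivations.
  data _⇛_ {V : Set} : Term ℬ V → Term ℬ V → Set where
    prim     : ∀ X → prim X ⇛ prim X
    var      : ∀ x → var x ⇛ var x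
    app      : {P P′ Q Q′ : Term ℬ V} → P ⇛ P′ → Q ⇛ Q′ → P · Q ⇛ P′ · Q′
    contract : {P : Term ℬ V} → ∀ X {Ns Ms : Vec (Term ℬ V) (arity X)} → P ≡ prim X ·* Ns → Pointwise _⇛_ Ns Ms →
               P ⇛ instantiate (rhs X) Ms

  ⇛-refl : {P : Term ℬ V} → P ⇛ P
  ⇛-refl {P = prim X} = prim X
  ⇛-refl {P = var x}  = var x
  ⇛-refl {P = P · Q}  = app ⇛-refl ⇛-refl

  ⟶⇒⇛ : P ⟶ Q → P ⇛ Q
  ⟶⇒⇛ (contract X Ns) = contract X refl (Pointwise.refl ⇛-refl)
  ⟶⇒⇛ (appˡ r)        = app (⟶⇒⇛ r) ⇛-refl
  ⟶⇒⇛ (appʳ r)        = app ⇛-refl (⟶⇒⇛ r)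

  mutual
    ⇛⇒⟶* : P ⇛ Q → P ⟶* Q
    ⇛⇒⟶* (prim X)               = ε
    ⇛⇒⟶* (var x)                = ε
    ⇛⇒⟶* (app r s)              = ·-cong-⟶* (⇛⇒⟶* r) (⇛⇒⟶* s)
    ⇛⇒⟶* (contract X refl rs) = ·*-cong-⟶* ε (⇛⇒⟶*s rs) ◅◅ contract X _ ◅ ε

    ⇛⇒⟶*s : Pointwise _⇛_ Ns Ms → Pointwise _⟶*_ Ns Ms
    ⇛⇒⟶*s []       = []
    ⇛⇒⟶*s (r ∷ rs) = ⇛⇒⟶* r ∷ ⇛⇒⟶*s rs

  ·*-cong-⇛ : P ⇛ Q → Pointwise _⇛_ Ns Ms → P ·* Ns ⇛ Q ·* Ms
  ·*-cong-⇛ r []       = r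
  ·*-cong-⇛ r (s ∷ ss) = ·*-cong-⇛ (app r s) ss

  instantiate-⇛ : (M : Rhs m) → Pointwise _⇛_ Ns Ms → instantiate M Ns ⇛ instantiate M Ms
  instantiate-⇛ (arg i) rs = Pointwise.lookup rs i
  instantiate-⇛ (M · N) rs = app (instantiate-⇛ M rs) (instantiate-⇛ N rs)

  data Spine⇛ {V : Set} (P : Term ℬ V) (Ns : Vec (Term ℬ V) m) : Term ℬ V → Set where
    inside : {P′ : Term ℬ V} {Ms : Vec (Term ℬ V) m} → P ⇛ P′ → Pointwise _⇛_ Ns Ms → Spine⇛ P Ns (P′ ·* Ms)
    root   : ∀ X {Ls Ms : Vec (Term ℬ V) (arity X)} → P ·* Ns ≡ prim X ·* Ls → Pointwise _⇛_ Ls Ms →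
             Spine⇛ P Ns (instantiate (rhs X) Ms)

  -- Proper prefixes of a redex lack an argument, so contraction is only possible at the root.
  spine-⇛ : (P : Term ℬ V) (Ns : Vec (Term ℬ V) m) → Lacks m P → P ·* Ns ⇛ Q → Spine⇛ P Ns Q
  spine-⇛ P []       l r = inside r []
  spine-⇛ P (N ∷ []) l (app r s)          = inside r (s ∷ [])
  spine-⇛ P (N ∷ []) l (contract X eq rs) = root X eq rs
  spine-⇛ P (N ∷ Ns@(_ ∷ _)) l r with spine-⇛ (P · N) Ns (app l) r
  ... | inside (app s t) ts = inside s (t ∷ ts)
  ... | inside (contract X {Ls} eq _) _ with () ← Lacks-unique (app l) (redex-saturated X Ls eq)
  ... | root X eq rs = root X eq rs

  size-≤-·* : (P : Term ℬ V) (Ns : Vec (Term ℬ V) m) → size P ≤ size (P ·* Ns)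
  size-≤-·* P []       = ≤-refl
  size-≤-·* P (N ∷ Ns) = ≤-trans (≤-trans (m≤m+n _ _) (n≤1+n _)) (size-≤-·* (P · N) Ns)

  size-args-< : (P : Term ℬ V) (Ns : Vec (Term ℬ V) m) → VecAll.All (λ N → size N < size (P ·* Ns)) Ns
  size-args-< P []       = VecAll.[]
  size-args-< P (N ∷ Ns) =
    ≤-trans (s≤s (m≤n+m (size N) (size P))) (size-≤-·* (P · N) Ns) VecAll.∷ size-args-< (P · N) Ns

  Joinable : Term ℬ V → Term ℬ V → Set
  Joinable P Q = ∃[ R ] P ⇛ R × Q ⇛ R

  joinable-sym : Joinable P Q → Joinable Q P
  joinable-sym (R , r , s) = R , s , r

  mutual
    -- The rules do not overlap: any further redex within a redex lies inside one of its arguments.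
    -- The recursion is on a bound for the size, since the derivations for those arguments come out
    -- of `spine-⇛` and are not structurally smaller.
    diamond : ∀ n → size P < n → P ⇛ Q → P ⇛ R → Joinable Q R
    diamond n _ (prim X) r = _ , r , ⇛-refl
    diamond n _ (var x)  r = _ , r , ⇛-refl
    diamond n _ r (prim X) = _ , ⇛-refl , r
    diamond n _ r (var x)  = _ , ⇛-refl , r
    diamond (suc n) (s≤s h) (app r s) (app r′ s′)
      with U , u , u′ ← diamond n (≤-trans (s≤s (m≤m+n _ _)) h) r r′
         | V , v , v′ ← diamond n (≤-trans (s≤s (m≤n+m _ _)) h) s s′
      = U · V , app u v , app u′ v′
    diamond (suc n) (s≤s h) (contract X eq rs) r = diamond-root n X eq h rs r
    diamond (suc n) (s≤s h) r@(app _ _) (contract X eq rs) = joinable-sym (diamond-root n X eq h rs r)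

    diamond-root : ∀ n X {Ns Ms : Vec (Term ℬ V) (arity X)} → P ≡ prim X ·* Ns →
                   size P ≤ n → Pointwise _⇛_ Ns Ms → P ⇛ Q → Joinable (instantiate (rhs X) Ms) Q
    diamond-root n X {Ns} refl h rs r with spine-⇛ (prim X) Ns (prim X) r
    -- The spine survives this step, so its root can still be contracted while the arguments are
    -- joined.
    ... | inside {Ms = Ks} (prim .X) ss
      with _ , us , vs ← diamonds n (VecAll.map (λ l → ≤-trans l h) (size-args-< (prim X) Ns)) rs ss
      = _ , instantiate-⇛ (rhs X) us , contract X {Ks} refl vs
    -- A bare primitive is a redex only if its arity is zero.
    ... | inside (contract Y {Ls} eq _) _ = contradiction
      (Lacks-unique (prim X) (redex-saturated Y Ls eq)) (≢-nonZero⁻¹ (arity X) {{arity-nonZero X}})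
    ... | root Y {Ls} eq ss with same ← redex-injective X Y Ns Ls eq
      with _ , us , vs ← diamonds n (VecAll.map (λ l → ≤-trans l h) (size-args-< (prim X) Ns)) rs ss
      = _ , instantiate-⇛ (rhs X) us , instantiate-⇛ (rhs X) vs

    diamonds : ∀ n {Ls : Vec (Term ℬ V) m} → VecAll.All (λ N → size N < n) Ls →
               Pointwise _⇛_ Ls Ns → Pointwise _⇛_ Ls Ms →
               Σ[ Ks ∈ Vec (Term ℬ V) m ] Pointwise _⇛_ Ns Ks × Pointwise _⇛_ Ms Ks
    diamonds n VecAll.[] [] [] = [] , [] , []
    diamonds n (h VecAll.∷ hs) (r ∷ rs) (s ∷ ss)
      with K , u , v ← diamond n h r s
         | Ks , us , vs ← diamonds n hs rs ss
      = K ∷ Ks , u ∷ us , v ∷ vs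

  private
    _⇛*_ : Term ℬ V → Term ℬ V → Set
    _⇛*_ = Star _⇛_

  strip : P ⇛ Q → P ⇛* R → ∃[ U ] Q ⇛* U × R ⇛ U
  strip r ε        = _ , ε , r
  strip r (s ◅ ss) with _ , r′ , s′ ← diamond _ ≤-refl s r
                   with _ , ss′ , r″ ← strip r′ ss
    = _ , s′ ◅ ss′ , r″

  ⇛-confluent : Confluent (_⇛_ {V})
  ⇛-confluent ε        ss = _ , ss , ε
  ⇛-confluent (r ◅ rs) ss with _ , ss′ , r′ ← strip r ss
                          with _ , ts , rs′ ← ⇛-confluent rs ss′
    = _ , ts , r′ ◅ rs′

  -- Parallel reduction lies between `_⟶_` and `_⟶*_`, so `_⟶_` and `_⇛_` have the same reflexive
  -- transitive closure.
  ⟶-confluent : Confluent (_⟶_ {ℬ} {V})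
  ⟶-confluent rs ss with _ , rs′ , ss′ ← ⇛-confluent (gmap _ ⟶⇒⇛ rs) (gmap _ ⟶⇒⇛ ss)
    = _ , kleisliStar _ ⇛⇒⟶* rs′ , kleisliStar _ ⇛⇒⟶* ss′

  -- Normal forms and substitution

  IsNF : Term ℬ V → Set
  IsNF = IsNormalForm _⟶_

  -- An inversion view of `_⟶_`: a contraction at the root is recorded only as saturation,
  -- `Lacks 0`, which is enough to refute it and can be matched on where `prim X ·* Ns` cannot.
  data Step {V : Set} : Term ℬ V → Set where
    here : {P : Term ℬ V} → Lacks 0 P → Step P
    appˡ : {P P′ Q : Term ℬ V} → P ⟶ P′ → Step (P · Q)
    appʳ : {P Q Q′ : Term ℬ V} → Q ⟶ Q′ → Step (P · Q)

  step : P ⟶ Q → Step P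
  step (contract X Ns) = here (Lacks-·* Ns (prim X))
  step (appˡ r)        = appˡ r
  step (appʳ r)        = appʳ r

  prim-normal : ∀ X → IsNF {V} (prim X)
  prim-normal X (_ , r) with step r
  ... | here l = contradiction (Lacks-unique (prim X) l) (≢-nonZero⁻¹ (arity X) {{arity-nonZero X}})

  var-normal : (x : V) → IsNF (var x)
  var-normal x (_ , r) with step r
  ... | here ()

  ·-normal : ¬ Lacks 0 (P · Q) → IsNF P → IsNF Q → IsNF (P · Q)
  ·-normal ¬l p q (_ , r) with step r
  ... | here l = ¬l l
  ... | appˡ s = p (_ , s)
  ... | appʳ s = q (_ , s)

  bind : (V → Term ℬ W) → Term ℬ V → Term ℬ W
  bind σ (prim X) = prim X
  bind σ (var x)  = σ x
  bind σ (P · Q)  = bind σ P · bind σ Q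

  bind-weaken : (σ : V → Combinator ℬ) (P : Combinator ℬ) → bind σ (weaken P) ≡ P
  bind-weaken σ (prim X) = refl
  bind-weaken σ (P · Q)  = cong₂ _·_ (bind-weaken σ P) (bind-weaken σ Q)

  bind-·* : (σ : V → Term ℬ W) (P : Term ℬ V) (Ns : Vec (Term ℬ V) m) →
            bind σ (P ·* Ns) ≡ bind σ P ·* Vec.map (bind σ) Ns
  bind-·* σ P []       = refl
  bind-·* σ P (N ∷ Ns) = bind-·* σ (P · N) Ns

  bind-instantiate : (σ : V → Term ℬ W) (M : Rhs m) (Ns : Vec (Term ℬ V) m) →
                     bind σ (instantiate M Ns) ≡ instantiate M (Vec.map (bind σ) Ns)
  bind-instantiate σ (arg i) Ns = sym (lookup-map i (bind σ) Ns)
  bind-instantiate σ (M · N) Ns = cong₂ _·_ (bind-instantiate σ M Ns) (bind-instantiate σ N Ns)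

  bind-⟶ : (σ : V → Term ℬ W) → P ⟶ Q → bind σ P ⟶ bind σ Q
  bind-⟶ σ (contract X Ns)
    rewrite bind-·* σ (prim X) Ns | bind-instantiate σ (rhs X) Ns = contract X (Vec.map (bind σ) Ns)
  bind-⟶ σ (appˡ r) = appˡ (bind-⟶ σ r)
  bind-⟶ σ (appʳ r) = appʳ (bind-⟶ σ r)

  -- Reduction of the combinators representing K and S

  module _ {N} (isK : ExtensionallyK {ℬ} N) where

    -- By confluence a term convertible to a normal form reduces to it; the variables are then
    -- instantiated, since reduction is stable under substitution.
    K-reduces : (P Q : Combinator ℬ) → N · P · Q ⟶* P
    K-reduces P Q = subst (λ U → U · P · Q ⟶* P) (bind-weaken σ N)
      (gmap (bind σ) (bind-⟶ σ) (conf⇒nf ⟶-confluent (var-normal 0F) isK))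
      where
      σ : Fin 3 → Combinator ℬ
      σ 0F = P
      σ 1F = Q
      -- An arbitrary value: `z` occurs at neither end of the reduction.
      σ 2F = Q

  module _ {N} (isS : ExtensionallyS {ℬ} N) where

    S-reduces : (P Q R : Combinator ℬ) → N · P · Q · R ⟶* P · R · (Q · R)
    S-reduces P Q R = subst (λ U → U · P · Q · R ⟶* P · R · (Q · R)) (bind-weaken σ N)
      (gmap (bind σ) (bind-⟶ σ) (conf⇒nf ⟶-confluent normal isS))
      where
      σ : Fin 3 → Combinator ℬ
      σ 0F = P
      σ 1F = Q
      σ 2F = R

      -- Every spine has a variable at its head, so no application in the term is saturated.
      normal : IsNF (var 0F · var 2F · (var 1F · var 2F))
      normal = ·-normal (λ { (app (app ())) })
        (·-normal (λ { (app ()) }) (var-normal 0F) (var-normal 2F))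
        (·-normal (λ { (app ()) }) (var-normal 1F) (var-normal 2F))

  -- The type whose negation is `StronglyNormalising`.
  Diverges : Combinator ℬ → Set
  Diverges P = Σ[ f ∈ (ℕ → Combinator ℬ) ] f 0 ≡ P × (∀ i → f i ⟶ f (suc i))

  appˡ-diverges : {P Q : Combinator ℬ} → Diverges P → Diverges (P · Q)
  appˡ-diverges {Q = Q} (f , f0 , steps) = (λ i → f i · Q) , cong (_· Q) f0 , λ i → appˡ (steps i)

  appʳ-diverges : {P Q : Combinator ℬ} → Diverges Q → Diverges (P · Q)
  appʳ-diverges {P = P} (f , f0 , steps) = (λ i → P · f i) , cong (P ·_) f0 , λ i → appʳ (steps i)

  cycle-diverges : {P Q : Combinator ℬ} → P ⟶ Q → Q ⟶* P → Diverges P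
  cycle-diverges {P} {Q} r rs = (λ i → proj₁ (walk i)) , refl , λ i → next-step (walk i)
    where
    -- The state is a current term with its remaining reduction to `P`. When that is exhausted the
    -- term is `P`, and the step `r` opens another round; giving this step separately keeps the
    -- cycle nonempty.
    next : ∃[ U ] U ⟶* P → ∃[ U ] U ⟶* P
    next (_ , ε)      = Q , rs
    next (_ , s ◅ ss) = _ , ss

    next-step : ∀ U → proj₁ U ⟶ proj₁ (next U)
    next-step (_ , ε)      = r
    next-step (_ , s ◅ ss) = s

    walk : ℕ → ∃[ U ] U ⟶* P
    walk zero    = P , ε
    walk (suc i) = next (walk i)

  first-step : P ⟶* Q → P ≢ Q → ∃[ R ] P ⟶ R × R ⟶* Q
  first-step ε        P≢P = contradiction refl P≢P
  first-step (r ◅ rs) _   = _ , r , rs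

  -- ω ω for ω = S I I and I = S K K, which returns to itself after a positive number of steps.
  divergent-combinator : TuringComplete ℬ → ∃ Diverges
  divergent-combinator ((S , isS) , (K , isK)) = ω · ω , cycle-diverges r (rs ◅◅ ·-cong-⟶* I-reduces I-reduces)
    where
    I ω : Combinator ℬ
    I = S · K · K
    ω = S · I · I

    I-reduces : ∀ {P} → I · P ⟶* P
    I-reduces = S-reduces isS K K _ ◅◅ K-reduces isK _ _

    -- Equality would force `S ≡ S · K`. Hence the reduction has a first step, as the cycle
    -- requires.
    ωω≢ : ω · ω ≢ I · ω · (I · ω)
    ωω≢ ()

    unwound = first-step (S-reduces isS I I ω) ωω≢
    r  = proj₁ (proj₂ unwound)
    rs = proj₂ (proj₂ unwound)

-- The limit

toℚᵘ-/ : ∀ m n → toℚᵘ (+ m / suc n) ℚᵘ.≃ mkℚᵘ (+ m) n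
toℚᵘ-/ m n = ℚ.toℚᵘ-fromℚᵘ (mkℚᵘ (+ m) n)

/-distribˡ-+ : ∀ p r q .{{_ : NonZero q}} → + (p + r) / q ≡ + p / q ℚ.+ + r / q
/-distribˡ-+ p r (suc q) = ℚ.toℚᵘ-injective (begin
  toℚᵘ (+ (p + r) / suc q)                     ≈⟨ toℚᵘ-/ (p + r) q ⟩
  mkℚᵘ (+ (p + r)) q                           ≈⟨ *≡* (lemma (+ p) (+ r) (+ suc q)) ⟩
  mkℚᵘ (+ p) q ℚᵘ.+ mkℚᵘ (+ r) q               ≈⟨ ℚᵘ.+-cong (toℚᵘ-/ p q) (toℚᵘ-/ r q) ⟨
  toℚᵘ (+ p / suc q) ℚᵘ.+ toℚᵘ (+ r / suc q)   ≈⟨ ℚ.toℚᵘ-homo-+ (+ p / suc q) (+ r / suc q) ⟨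
  toℚᵘ (+ p / suc q ℚ.+ + r / suc q)           ∎)
  where
  open ℚᵘ.≃-Reasoning
  lemma : ∀ p r q → (p ℤ.+ r) ℤ.* (q ℤ.* q) ≡ (p ℤ.* q ℤ.+ r ℤ.* q) ℤ.* q
  lemma = ℤ.solve-∀

n/n≡1 : ∀ q .{{_ : NonZero q}} → + q / q ≡ 1ℚ
n/n≡1 (suc q) = ℚ.toℚᵘ-injective (ℚᵘ.≃-trans (toℚᵘ-/ (suc q) q) (*≡* (ℤ.*-comm (+ suc q) (+ 1))))

-- Since `1 = p / q + r / q`, the limit amounts to making the proportion of the remainder `r` small.
∣/-1∣ : ∀ p r q .{{_ : NonZero q}} → q ≡ p + r → ∣ + p / q - 1ℚ ∣ ≡ + r / q
∣/-1∣ p r q q≡p+r = begin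
  ∣ x - 1ℚ ∣             ≡⟨ cong (λ u → ∣ x - u ∣) 1≡x+y ⟩
  ∣ x - (x ℚ.+ y) ∣      ≡⟨ cong ∣_∣ x-[x+y]≡-y ⟩
  ∣ ℚ.- y ∣              ≡⟨ ℚ.∣-p∣≡∣p∣ y ⟩
  ∣ y ∣                  ≡⟨ ℚ.0≤p⇒∣p∣≡p (ℚ.nonNegative⁻¹ y {{ℚ.normalize-nonNeg r q}}) ⟩
  y                      ∎
  where
  open ≡-Reasoning
  x = + p / q
  y = + r / q
  1≡x+y : 1ℚ ≡ x ℚ.+ y
  1≡x+y = trans (sym (n/n≡1 q)) (trans (cong (λ m → + m / q) q≡p+r) (/-distribˡ-+ p r q))
  x-[x+y]≡-y : x - (x ℚ.+ y) ≡ ℚ.- y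
  x-[x+y]≡-y = begin
    x - (x ℚ.+ y)              ≡⟨ cong (x ℚ.+_) (ℚ.neg-distrib-+ x y) ⟩
    x ℚ.+ (ℚ.- x ℚ.+ ℚ.- y)    ≡⟨ ℚ.+-assoc x (ℚ.- x) (ℚ.- y) ⟨
    x - x ℚ.+ ℚ.- y            ≡⟨ cong (ℚ._+ ℚ.- y) (ℚ.+-inverseʳ x) ⟩
    0ℚ ℚ.+ ℚ.- y               ≡⟨ ℚ.+-identityˡ (ℚ.- y) ⟩
    ℚ.- y                      ∎

-- A positive rational is at least the reciprocal of its denominator, so bounding `r / q` by that
-- reciprocal suffices.
/-< : ∀ r q {δ} .{{_ : NonZero q}} → 0ℚ ℚ.< δ → r * ℚ.↧ₙ δ < q → + r / q ℚ.< δ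
/-< r (suc q) {mkℚ (+ zero) _ _} 0<δ r< = contradiction (ℚ.positive 0<δ) λ ()
/-< r (suc q) {mkℚ (+ suc e) d _} 0<δ r< =
  ℚ.toℚᵘ-cancel-< (ℚᵘ.<-respˡ-≃ (ℚᵘ.≃-sym (toℚᵘ-/ r q)) (*<* bound))
  where
  bound : + r ℤ.* + suc d ℤ.< + suc e ℤ.* + suc q
  bound rewrite sym (ℤ.pos-* r (suc d)) = +<+ (≤-trans r< (m≤m+n (suc q) (e * suc q)))
/-< r (suc q) {mkℚ ℤ.-[1+ _ ] _ _} 0<δ r< = contradiction (ℚ.positive 0<δ) λ ()

-- Multiplying r N ≥ q > 0 by n + 1 > C N contradicts r (n + 1) ≤ C q.
ratio-small : ∀ r q C N {n} .{{_ : NonZero q}} .{{_ : NonZero N}} → r * suc n ≤ C * q → C * N ≤ n → r * N < q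
ratio-small r q C N {n} r≤ CN≤n = ≰⇒> λ q≤rN → <-irrefl refl (begin-strict
  C * N * q        ≤⟨ *-monoˡ-≤ q CN≤n ⟩
  n * q            <⟨ *-monoˡ-< q (n<1+n n) ⟩
  suc n * q        ≤⟨ *-monoʳ-≤ (suc n) q≤rN ⟩
  suc n * (r * N)  ≡⟨ lemma₁ (suc n) r N ⟩
  r * suc n * N    ≤⟨ *-monoˡ-≤ N r≤ ⟩
  C * q * N        ≡⟨ lemma₂ C q N ⟩
  C * N * q        ∎)
  where
  open ≤-Reasoning
  lemma₁ : ∀ m r N → m * (r * N) ≡ r * m * N
  lemma₁ = solve-∀
  lemma₂ : ∀ C q N → C * q * N ≡ C * N * q
  lemma₂ = solve-∀

forestCount-positive : ∀ b .{{_ : NonZero b}} n k → 0 < forestCount b n (suc k)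
forestCount-positive b zero    zero    = *-mono-< {0} {b} {0} {1} (>-nonZero⁻¹ b) ≤-refl
forestCount-positive b zero    (suc k) = *-mono-< {0} {b} {0} (>-nonZero⁻¹ b) (forestCount-positive b zero k)
forestCount-positive b (suc n) k       = ≤-trans (forestCount-positive b n (suc k)) (m≤n+m _ _)

-- Counting the weakly normalising combinators

module _ (ℬ : Basis) where
  open Basis ℬ

  argument-diverges : {D P : Combinator ℬ} → Diverges D → HasArgument D P → Diverges P
  argument-diverges d here      = appʳ-diverges d
  argument-diverges d (left h)  = appˡ-diverges (argument-diverges d h)
  argument-diverges d (right h) = appʳ-diverges (argument-diverges d h)

  -- Closed terms have only primitives as leaves. The leftmost one serves as a normal argument for
  -- `K` and shows that the basis is nonempty.
  aPrim : Combinator ℬ → Primitive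
  aPrim (prim X) = X
  aPrim (P · Q)  = aPrim P

  OfSize : (Combinator ℬ → Set) → ℕ → Combinator ℬ → Set
  OfSize R n P = size P ≡ n × R P

  WN WN∧¬SN : Combinator ℬ → Set
  WN       = WeaklyNormalising
  WN∧¬SN P = WeaklyNormalising P × ¬ StronglyNormalising P

  constantOverhead : Combinator ℬ → ℕ
  constantOverhead K = suc (suc (size K))

  -- `Q` can be read off from `K · prim X · Q`, and that term reduces to the normal form `prim X`
  -- whatever `Q` is.
  treeCount≤#WN : ∀ {K q} m → ExtensionallyK {ℬ} K → HasCardinality (OfSize WN (constantOverhead K + m)) q →
                  treeCount #prims m ≤ q
  treeCount≤#WN {K} m isK (ys , ys! , ys⇔ , refl) = begin
    treeCount #prims m              ≡⟨ length-ofSize m ⟨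
    length (ofSize m)               ≡⟨ length-map constant (ofSize m) ⟨
    length (map constant (ofSize m)) ≤⟨ Unique-⊆⇒length-≤ (Unique.map⁺ (λ { refl → refl }) (ofSize-unique m)) included ⟩
    length ys                       ∎
    where
    open ≤-Reasoning
    X = aPrim K
    constant : Combinator ℬ → Combinator ℬ
    constant Q = K · prim X · Q
    included : ∀ {P} → P ∈ map constant (ofSize m) → P ∈ ys
    included P∈ with Q , Q∈ , refl ← ∈-map⁻ constant P∈ = Equivalence.from (ys⇔ _)
      ( cong₂ (λ s t → suc (suc (s + t))) (+-identityʳ (size K)) (ofSize-size m Q∈)
      , prim X , prim-normal X , K-reduces isK (prim X) Q)

  -- A combinator counted by `q` but not by `p` cannot have `D` as an argument, since it would
  -- diverge. The syntactic test for `D` is decidable, unlike strong normalisation, and so can split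
  -- the list `ys`.
  WN-excess-bound : ∀ {D p q n} → Diverges D → HasCardinality (OfSize WN∧¬SN n) p → HasCardinality (OfSize WN n) q →
    ∃[ r ] q ≡ p + r × r * suc n ≤ treeCount #prims (suc (size D) + n)
  WN-excess-bound {D} {n = n} d (xs , xs! , xs⇔ , refl) (ys , ys! , ys⇔ , refl) =
    length ys ∸ length xs , sym (m+[n∸m]≡n p≤q) ,
    ≤-trans (*-monoˡ-≤ (suc n) (m≤n+o⇒m∸n≤o (length ys) (length xs) q≤p+f))
      (unmarked-bound (All.tabulate unmarked) (Unique.filter⁺ unmarked? ys!))
    where
    unmarked? = λ P → ¬? (hasArgument? D P)
    zs = filter unmarked? ys

    p≤q : length xs ≤ length ys
    p≤q = Unique-⊆⇒length-≤ xs! λ {P} P∈ →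
      let sz , wn , _ = Equivalence.to (xs⇔ P) P∈ in Equivalence.from (ys⇔ P) (sz , wn)

    unmarked : ∀ {P} → P ∈ zs → size P ≡ n × ¬ HasArgument D P
    unmarked P∈ with P∈ys , ¬D ← ∈-filter⁻ unmarked? {xs = ys} P∈ = proj₁ (Equivalence.to (ys⇔ _) P∈ys) , ¬D

    covered : ∀ {P} → P ∈ ys → P ∈ xs ++ zs
    covered {P} P∈ with hasArgument? D P
    ... | yes D∈ = let sz , wn = Equivalence.to (ys⇔ P) P∈ in
      ∈-++⁺ˡ (Equivalence.from (xs⇔ P) (sz , wn , λ sn → sn (argument-diverges d D∈)))
    ... | no ¬D = ∈-++⁺ʳ xs (∈-filter⁺ unmarked? P∈ ¬D)

    q≤p+f : length ys ≤ length xs + length zs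
    q≤p+f = ≤-trans (Unique-⊆⇒length-≤ ys! covered) (≤-reflexive (length-++ xs))

corollary19 : (ℬ : Basis) → TuringComplete ℬ →
    RatioTendsTo {Combinator ℬ}
    (λ n P → size P ≡ n × WeaklyNormalising P × ¬ StronglyNormalising P)
    (λ n P → size P ≡ n × WeaklyNormalising P)
    1ℚ
corollary19 ℬ tc@(_ , (K , isK)) δ 0<δ = n₀ , bound
  where
  open Basis ℬ
  Ω = proj₁ (divergent-combinator tc)
  Ω-diverges = proj₂ (divergent-combinator tc)
  c e C n₀ : ℕ
  c  = constantOverhead ℬ K
  e  = suc (size Ω)
  -- `C` absorbs the gap between the size `e + n` of the marked combinators and the size `n - c` of
  -- the arguments `Q`.
  C  = (4 * #prims) ^ (e + c)
  -- The first summand lets `n` be written as `c + m`; the second supplies the bound on `n` that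
  -- `ratio-small` requires.
  n₀ = c + C * ℚ.↧ₙ δ

  bound : ∀ n → n₀ ≤ n → ∀ p q → HasCardinality (OfSize ℬ (WN∧¬SN ℬ) n) p → HasCardinality (OfSize ℬ (WN ℬ) n) q →
          Σ[ q≢0 ∈ NonZero q ] ∣ _/_ (+ p) q {{q≢0}} - 1ℚ ∣ ℚ.< δ
  bound n n₀≤n p q #p #q with m≤n⇒∃[o]m+o≡n (≤-trans (m≤m+n c _) n₀≤n)
  ... | m , refl with r , q≡p+r , r≤ ← WN-excess-bound ℬ Ω-diverges #p #q =
    q≢0 , subst (ℚ._< δ) (sym (∣/-1∣ p r q {{q≢0}} q≡p+r))
      (/-< r q {{q≢0}} 0<δ (ratio-small r q C (ℚ.↧ₙ δ) {{q≢0}} r-bound (≤-trans (m≤n+m _ c) n₀≤n)))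
    where
    open ≤-Reasoning
    m≤q : treeCount #prims m ≤ q
    m≤q = treeCount≤#WN ℬ m isK #q

    q≢0 : NonZero q
    q≢0 = >-nonZero (≤-trans (forestCount-positive #prims {{Fin.nonZeroIndex (aPrim ℬ K)}} m 0) m≤q)

    r-bound : r * suc (c + m) ≤ C * q
    r-bound = begin
      r * suc (c + m)               ≤⟨ r≤ ⟩
      treeCount #prims (e + (c + m)) ≡⟨ cong (treeCount #prims) (+-assoc e c m) ⟨
      treeCount #prims (e + c + m)  ≤⟨ treeCount-growth #prims (e + c) m ⟩
      C * treeCount #prims m        ≤⟨ *-monoʳ-≤ C m≤q ⟩
      C * q                         ∎
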